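{- Let $q=2^r>2$ and $n\ge 1$. Then $$\beta_q^{(n)}(x_1,\dots,x_n)=\sum_{1\le i_1,\dots,i_n\le 2^r-2}x_1^{i_1}x_2^{i_2}\cdots x_n^{i_n}\;+\;x_1+\cdots+x_n$$ is a local permutation polynomial in $\mathbb{F}_q[x_1,\dots,x_n]$ of degree $n(2^r-2)$.
   Context: $\mathbb{F}_q$ is the finite field with $q$ elements. A polynomial $f\in\mathbb{F}_q[x_1,\dots,x_n]$ is a local permutation polynomial (LPP) if, for each $i\in\{1,\dots,n\}$ and each choice of $(a_1,\dots,a_{i-1},a_{i+1},\dots,a_n)\in\mathbb{F}_q^{n-1}$, the univariate polynomial $f(a_1,\dots,a_{i-1},x_i,a_{i+1},\dots,a_n)$ induces a bijection of $\mathbb{F}_q$. Degree means total degree. -}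

module Defs where

open import Level using (Level; _⊔_) renaming (suc to lsuc)
open import Algebra.Bundles using (CommutativeRing)
open import Data.Bool.Base using (if_then_else_)
open import Data.Fin.Base using (Fin)
open import Data.List.Base as List using (List; []; _∷_; _++_)
open import Data.Nat.Base as ℕ using (ℕ; zero; suc; pred; _∸_; _≤_)
import Data.Nat.Properties as ℕ
open import Data.Product.Base using (∃; _×_; _,_)
open import Data.Vec.Base as Vec using (Vec; []; _∷_; _[_]≔_)
import Data.Vec.Properties as Vec
open import Function.Bundles using (Inverse)
open import Function.Definitions using (Bijective)
open import Relation.Binary.PropositionalEquality using (_≡_; setoid)
open import Relation.Nullary using (¬_; Dec; does)

-- Discrete fields: every element that is not zero is invertible. (The
-- library's HeytingField is stated for a separate apartness relation.)
record Field (c ℓ : Level) : Set (lsuc (c ⊔ ℓ)) where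
  field
    commutativeRing : CommutativeRing c ℓ
  open CommutativeRing commutativeRing public
  field
    1≉0     : ¬ (1# ≈ 0#)
    inverse : ∀ x → ¬ (x ≈ 0#) → ∃ λ y → x * y ≈ 1#

HasCardinality : ∀ {c ℓ} → Field c ℓ → ℕ → Set (c ⊔ ℓ)
HasCardinality F q = Inverse (Field.setoid F) (setoid (Fin q))

Exponent : ℕ → Set
Exponent n = Vec ℕ n

_≟ᵉ_ : ∀ {n} (e e′ : Exponent n) → Dec (e ≡ e′)
_≟ᵉ_ = Vec.≡-dec ℕ._≟_

-- {1, …, m}ⁿ, each tuple listed exactly once.
box : ℕ → (n : ℕ) → List (Exponent n)
box m zero    = [] ∷ []
box m (suc n) = List.cartesianProductWith _∷_ (List.map suc (List.upTo m)) (box m n)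

module Polynomials {c ℓ} (F : Field c ℓ) where
  open Field F
  open import Algebra.Properties.Semiring.Exp semiring using (_^_)

  -- A polynomial in n variables is a formal finite sum of terms c·x^e. An
  -- exponent may occur repeatedly and with coefficient 0#; the coefficient
  -- of x^e in the polynomial is the one computed by coeff.
  Poly : ℕ → Set c
  Poly n = List (Carrier × Exponent n)

  sumᶠ : List Carrier → Carrier
  sumᶠ = List.foldr _+_ 0#

  coeff : ∀ {n} → Poly n → Exponent n → Carrier
  coeff f e = sumᶠ (List.map (λ (a , e′) → if does (e ≟ᵉ e′) then a else 0#) f)

  infixl 6 _+ₚ_
  _+ₚ_ : ∀ {n} → Poly n → Poly n → Poly n
  _+ₚ_ = _++_

  sumₚ : ∀ {n} → List (Poly n) → Poly n
  sumₚ = List.foldr _+ₚ_ []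

  monomial : ∀ {n} → Exponent n → Poly n
  monomial e = (1# , e) ∷ []

  var : ∀ {n} → Fin n → Poly n
  var {n} i = monomial (Vec.replicate n 0 [ i ]≔ 1)

  power : ∀ {n} → Vec Carrier n → Exponent n → Carrier
  power a e = Vec.foldr′ _*_ 1# (Vec.zipWith _^_ a e)

  eval : ∀ {n} → Poly n → Vec Carrier n → Carrier
  eval f a = sumᶠ (List.map (λ (b , e) → b * power a e) f)

  -- f(a₁,…,aᵢ₋₁,xᵢ,aᵢ₊₁,…,aₙ) as a polynomial in the single variable xᵢ; the
  -- n - 1 values aⱼ, j ≠ i, are listed in increasing order of j.
  specialise : ∀ {n} → Fin n → Vec Carrier (pred n) → Poly n → Poly 1
  specialise {suc n} i a =
    List.map (λ (b , e) → b * power a (Vec.removeAt e i) , Vec.lookup e i ∷ [])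

  induced : Poly 1 → Carrier → Carrier
  induced g x = eval g (x ∷ [])

  IsLPP : ∀ {n} → Poly n → Set (c ⊔ ℓ)
  IsLPP {n} f = (i : Fin n) (a : Vec Carrier (pred n)) →
                Bijective _≈_ _≈_ (induced (specialise i a f))

  -- In particular the zero polynomial has no degree.
  HasDegree : ∀ {n} → Poly n → ℕ → Set ℓ
  HasDegree {n} f d =
    (∃ λ (e : Exponent n) → Vec.sum e ≡ d × ¬ (coeff f e ≈ 0#)) ×
    (∀ (e : Exponent n) → ¬ (coeff f e ≈ 0#) → Vec.sum e ≤ d)

  β : (q n : ℕ) → Poly n
  β q n = sumₚ (List.map monomial (box (q ∸ 2) n)) +ₚ sumₚ (List.map var (List.allFin n))

{-# OPTIONS --safe #-}

-- On a field with q = 2^r elements put S(x) = x + x² + ⋯ + x^(q-2). Fermat's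
-- little theorem gives S(0) = S(1) = 0 and S(x) = 1 elsewhere, so S takes values
-- in {0, 1} and S(x + 1) = S(x). Since the large sum in β factors as
-- S(x₁)⋯S(xₙ), fixing all variables but one turns β into x ↦ S(x)·c + x + d with
-- c ∈ {0, 1}; and x ↦ S(x)·c + x is an involution because S is invariant under
-- adding S(x)·c ∈ {0, 1} and the characteristic is 2.
module Submission where

open import Defs
open import Algebra.Bundles using (CommutativeMonoid)
import Algebra.Properties.CommutativeMonoid.Sum as Sum
import Algebra.Properties.CommutativeSemigroup as CommutativeSemigroupProperties
import Algebra.Properties.Group as GroupProperties
import Algebra.Properties.Semiring.Exp as Exp
import Algebra.Properties.Semiring.Mult as Mult
open import Data.Bool.Base using (if_then_else_)
open import Data.Fin.Base using (Fin; zero; suc; punchIn)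
open import Data.Fin.Permutation using (Permutation′; permutation)
import Data.Fin.Properties as Fin
open import Data.List.Base as List using (List; []; _∷_; _++_)
import Data.List.Properties as List
open import Data.List.Membership.Propositional using (_∈_)
open import Data.List.Membership.Propositional.Properties using (∈-cartesianProductWith⁺; ∈-map⁺; ∈-upTo⁺)
open import Data.List.Relation.Unary.All as All using (All; []; _∷_)
import Data.List.Relation.Unary.All.Properties as All
open import Data.List.Relation.Unary.AllPairs using ([]; _∷_)
open import Data.List.Relation.Unary.Any using (here; there)
open import Data.List.Relation.Unary.Unique.Propositional using (Unique)
import Data.List.Relation.Unary.Unique.Propositional.Properties as Unique
open import Data.Nat.Base as ℕ using (ℕ; zero; suc; z≤n; s≤s)
import Data.Nat.Properties as ℕ
open import Data.Product.Base using (∃; _,_; proj₁; proj₂)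
open import Data.Sum.Base using (_⊎_; inj₁; inj₂)
open import Data.Vec.Base as Vec using (Vec; []; _∷_; _[_]≔_)
import Data.Vec.Properties as Vec
open import Function.Base using (_∘_)
open import Function.Bundles using (Inverse)
open import Function.Definitions using (Bijective)
open import Relation.Binary.PropositionalEquality as ≡ using (_≡_; _≢_)
import Relation.Binary.Reasoning.Setoid as ≈-Reasoning
open import Relation.Nullary using (¬_; Dec; yes; no; does; contradiction)
open import Relation.Nullary.Decidable using (decidable-stable)

-- Vectors with an inserted entry

zipWith-insertAt : ∀ {a b c} {A : Set a} {B : Set b} {C : Set c} (f : A → B → C) {n}
                   (xs : Vec A n) (ys : Vec B n) (i : Fin (suc n)) x y →
                   Vec.zipWith f (Vec.insertAt xs i x) (Vec.insertAt ys i y) ≡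
                   Vec.insertAt (Vec.zipWith f xs ys) i (f x y)
zipWith-insertAt f xs       ys       zero    x y = ≡.refl
zipWith-insertAt f (u ∷ xs) (v ∷ ys) (suc i) x y =
  ≡.cong (f u v ∷_) (zipWith-insertAt f xs ys i x y)

module _ {c ℓ} (M : CommutativeMonoid c ℓ) where
  open CommutativeMonoid M
  open CommutativeSemigroupProperties commutativeSemigroup using (x∙yz≈y∙xz)

  -- By commutativity the inserted entry moves to the front past each earlier one. Any commutative
  -- monoid is allowed because both the products and the sums in the values of β are treated this
  -- way.
  foldr′-insertAt : ∀ {n} (xs : Vec Carrier n) (i : Fin (suc n)) x →
                    Vec.foldr′ _∙_ ε (Vec.insertAt xs i x) ≈ x ∙ Vec.foldr′ _∙_ ε xs
  foldr′-insertAt xs       zero    x = refl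
  foldr′-insertAt (y ∷ xs) (suc i) x =
    trans (∙-congˡ (foldr′-insertAt xs i x)) (x∙yz≈y∙xz y x _)

-- Exponents

unitExponent : ∀ {n} → Fin n → Exponent n
unitExponent {n} i = Vec.replicate n 0 [ i ]≔ 1

sum-replicate : ∀ n m → Vec.sum (Vec.replicate n m) ≡ n ℕ.* m
sum-replicate zero    m = ≡.refl
sum-replicate (suc n) m = ≡.cong (m ℕ.+_) (sum-replicate n m)

sum-unitExponent : ∀ {n} (i : Fin n) → Vec.sum (unitExponent i) ≡ 1
sum-unitExponent {suc n} zero    = ≡.cong suc (≡.trans (sum-replicate n 0) (ℕ.*-zeroʳ n))
sum-unitExponent         (suc i) = sum-unitExponent i

-- The entries at `i` differ: `m` against 1. Hence no linear term contributes to the coefficient of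
-- the top exponent.
replicate≢unitExponent : ∀ {n m} (i : Fin n) → 2 ℕ.≤ m → Vec.replicate n m ≢ unitExponent i
replicate≢unitExponent {n} {m} i 2≤m eq = ℕ.<⇒≢ 2≤m (≡.sym (begin
  m                                 ≡⟨ Vec.lookup-replicate i m ⟨
  Vec.lookup (Vec.replicate n m) i  ≡⟨ ≡.cong (λ e → Vec.lookup e i) eq ⟩
  Vec.lookup (unitExponent i) i     ≡⟨ Vec.lookup∘updateAt i (Vec.replicate n 0) ⟩
  1                                 ∎))
  where open ≡.≡-Reasoning

-- Repetitions would turn coefficients into multiples of 1, which may vanish in characteristic 2.
box-unique : ∀ m n → Unique (box m n)
box-unique m zero    = [] ∷ []
box-unique m (suc n) =
  Unique.cartesianProductWith⁺ _∷_ Vec.∷-injective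
    (Unique.map⁺ ℕ.suc-injective (Unique.upTo⁺ m)) (box-unique m n)

box-sum≤ : ∀ m n → All (λ e → Vec.sum e ℕ.≤ n ℕ.* m) (box m n)
box-sum≤ m zero    = z≤n ∷ []
box-sum≤ m (suc n) =
  All.cartesianProductWith⁺ (≡.setoid _) (≡.setoid _) _∷_ _ (box m n)
    λ k∈ e∈ → ℕ.+-mono-≤ (All.lookup (All.map⁺ {P = ℕ._≤ m} (All.all-upTo m)) k∈) (All.lookup (box-sum≤ m n) e∈)

replicate∈box : ∀ m n → Vec.replicate n (suc m) ∈ box (suc m) n
replicate∈box m zero    = here ≡.refl
replicate∈box m (suc n) =
  ∈-cartesianProductWith⁺ _∷_ (∈-map⁺ suc (∈-upTo⁺ (ℕ.n<1+n m))) (replicate∈box m n)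

-- Cancellation and the characteristic of a field

module FieldProperties {c ℓ} (F : Field c ℓ) where
  open Field F hiding (zero)
  open Mult semiring using (_×_; ×-homo-1; ×1-homo-*)
  open ≈-Reasoning setoid

  *-cancelˡ : ∀ {x y z} → ¬ (x ≈ 0#) → x * y ≈ x * z → y ≈ z
  *-cancelˡ {x} {y} {z} x≉0 xy≈xz with inverse x x≉0
  ... | w , xw≈1 = begin
    y            ≈⟨ unit y ⟨
    w * (x * y)  ≈⟨ *-congˡ xy≈xz ⟩
    w * (x * z)  ≈⟨ unit z ⟩
    z            ∎
    where
    unit : ∀ u → w * (x * u) ≈ u
    unit u = begin
      w * (x * u)  ≈⟨ *-assoc w x u ⟨
      w * x * u    ≈⟨ *-congʳ (trans (*-comm w x) xw≈1) ⟩
      1# * u       ≈⟨ *-identityˡ u ⟩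
      u            ∎

  x*y≉0 : ∀ {x y} → ¬ (x ≈ 0#) → ¬ (y ≈ 0#) → ¬ (x * y ≈ 0#)
  x*y≉0 {x} x≉0 y≉0 xy≈0 = y≉0 (*-cancelˡ x≉0 (trans xy≈0 (sym (zeroʳ x))))

  -- The multiple is a product of `r` factors 1 + 1, and nonzero elements have a nonzero product.
  -- The conclusion is doubly negated because equality in an arbitrary `Field` need not be
  -- decidable.
  2^r×1≈0⇒¬1+1≉0 : ∀ r → (2 ℕ.^ r) × 1# ≈ 0# → ¬ ¬ (1# + 1# ≈ 0#)
  2^r×1≈0⇒¬1+1≉0 zero    eq _     = 1≉0 (trans (sym (×-homo-1 1#)) eq)
  2^r×1≈0⇒¬1+1≉0 (suc r) eq 1+1≉0 =
    x*y≉0 (1+1≉0 ∘ trans (+-congˡ (sym (×-homo-1 1#)))) (λ eq′ → 2^r×1≈0⇒¬1+1≉0 r eq′ 1+1≉0)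
      (trans (sym (×1-homo-* 2 (2 ℕ.^ r))) eq)

-- Finite fields: decidable equality, permutations, additive order of 1

module FiniteFieldProperties {c ℓ} (F : Field c ℓ) {q : ℕ} (card : HasCardinality F q) where
  open Field F hiding (zero)
  open FieldProperties F
  open Inverse card using (to; from; to-cong; from-cong; strictlyInverseˡ; strictlyInverseʳ)
  open Mult semiring using (_×_)
  open GroupProperties +-group using (identityʳ-unique)
  open ≈-Reasoning setoid
  module Σ = Sum +-commutativeMonoid
  module Π = Sum *-commutativeMonoid

  infix 4 _≟_
  _≟_ : ∀ x y → Dec (x ≈ y)
  x ≟ y with to x Fin.≟ to y
  ... | yes eq = yes (begin
    x            ≈⟨ strictlyInverseʳ x ⟨
    from (to x)  ≈⟨ from-cong eq ⟩
    from (to y)  ≈⟨ strictlyInverseʳ y ⟩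
    y            ∎)
  ... | no neq = no (neq ∘ to-cong)

  -- Sums and products over the field are indexed by `Fin q`, so a bijection of the field has to
  -- become a permutation of indices before it can be used to reorder them.
  conjugate : (f g : Carrier → Carrier) → (∀ {x y} → x ≈ y → f x ≈ f y) → (∀ {x y} → x ≈ y → g x ≈ g y) →
              (∀ x → f (g x) ≈ x) → (∀ x → g (f x) ≈ x) → Permutation′ q
  conjugate f g f-cong g-cong fg gf =
    permutation (λ i → to (f (from i))) (λ i → to (g (from i))) (inv f g f-cong fg) (inv g f g-cong gf)
    where
    inv : ∀ h k → (∀ {x y} → x ≈ y → h x ≈ h y) → (∀ x → h (k x) ≈ x) →
          ∀ i → to (h (from (to (k (from i))))) ≡ i
    inv h k h-cong hk i =
      ≡.trans (to-cong (trans (h-cong (strictlyInverseʳ _)) (hk (from i)))) (strictlyInverseˡ i)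

  -- Translation by 1 permutes the field, so it does not change the sum of all elements.
  q×1≈0 : q × 1# ≈ 0#
  q×1≈0 = identityʳ-unique (Σ.sum from) (q × 1#) (begin
    Σ.sum from + q × 1#                  ≈⟨ +-congˡ (Σ.sum-replicate q) ⟨
    Σ.sum from + Σ.sum {q} (λ _ → 1#)    ≈⟨ Σ.∑-distrib-+ from (λ _ → 1#) ⟨
    Σ.sum (λ i → from i + 1#)            ≈⟨ Σ.sum-cong-≋ (λ i → strictlyInverseʳ (from i + 1#)) ⟨
    Σ.sum (λ i → from (to (from i + 1#))) ≈⟨ Σ.sum-permute from shift ⟨
    Σ.sum from                           ∎)
    where
    open GroupProperties +-group using (//-rightDividesˡ; //-rightDividesʳ)
    shift : Permutation′ q
    shift = conjugate (_+ 1#) (_- 1#) +-congʳ +-congʳ (//-rightDividesˡ 1#) (//-rightDividesʳ 1#)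

-- Fermat's little theorem

module _ {c ℓ} (F : Field c ℓ) {p : ℕ} (card : HasCardinality F (suc p)) where
  open Field F hiding (zero)
  open FieldProperties F
  open FiniteFieldProperties F card
  open Inverse card using (to; from; to-cong; from-cong; strictlyInverseʳ)
  open Exp semiring using (_^_)
  open ≈-Reasoning setoid

  private
    i₀ : Fin (suc p)
    i₀ = to 0#

    except₀ : (Fin (suc p) → Carrier) → Fin (suc p) → Carrier
    except₀ f i = if does (i Fin.≟ i₀) then 1# else f i

    from≈0⇒≡i₀ : ∀ {i} → from i ≈ 0# → i ≡ i₀
    from≈0⇒≡i₀ {i} eq = ≡.trans (≡.sym (Inverse.strictlyInverseˡ card i)) (to-cong eq)

    except₀-≉0 : ∀ {f} → (∀ i → i ≢ i₀ → ¬ (f i ≈ 0#)) → ∀ i → ¬ (except₀ f i ≈ 0#)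
    except₀-≉0 nz i with i Fin.≟ i₀
    ... | yes _   = 1≉0
    ... | no i≢i₀ = nz i i≢i₀

    except₀-≢ : ∀ f {i} → i ≢ i₀ → except₀ f i ≈ f i
    except₀-≢ f {i} i≢i₀ with i Fin.≟ i₀
    ... | yes i≡i₀ = contradiction i≡i₀ i≢i₀
    ... | no _     = refl

    except₀-i₀ : ∀ f {i} → i ≡ i₀ → except₀ f i ≈ 1#
    except₀-i₀ f {i} i≡i₀ with i Fin.≟ i₀
    ... | yes _    = refl
    ... | no  i≢i₀ = contradiction i≡i₀ i≢i₀

    ∏≉0 : ∀ {n} (f : Fin n → Carrier) → (∀ i → ¬ (f i ≈ 0#)) → ¬ (Π.sum f ≈ 0#)
    ∏≉0 {zero}  f nz = 1≉0
    ∏≉0 {suc n} f nz = x*y≉0 (nz zero) (∏≉0 (f ∘ suc) (nz ∘ suc))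

    -- The index of 0 contributes 1, which leaves one factor `a` for each of the `p` nonzero
    -- elements.
    ∏-except₀-const : ∀ a → Π.sum (except₀ (λ _ → a)) ≈ a ^ p
    ∏-except₀-const a = begin
      Π.sum (except₀ (λ _ → a))  ≈⟨ Π.sum-remove {i = i₀} (except₀ (λ _ → a)) ⟩
      except₀ (λ _ → a) i₀ * Π.sum (λ j → except₀ (λ _ → a) (punchIn i₀ j))
        ≈⟨ *-cong (except₀-i₀ _ ≡.refl) (Π.sum-cong-≋ λ j → except₀-≢ _ (Fin.punchInᵢ≢i i₀ j)) ⟩
      1# * Π.sum {p} (λ _ → a)   ≈⟨ *-identityˡ _ ⟩
      Π.sum {p} (λ _ → a)        ≈⟨ Π.sum-replicate p ⟩
      a ^ p                      ∎

  -- Multiplication by a permutes the nonzero elements; to work over all of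
  -- Fin (suc p), the element 0 is replaced by 1 in their product.
  fermat : ∀ {a} → ¬ (a ≈ 0#) → a ^ p ≈ 1#
  fermat {a} a≉0 with inverse a a≉0
  ... | b , ab≈1 = *-cancelˡ P≉0 (begin
    P * a ^ p                          ≈⟨ *-comm _ _ ⟩
    a ^ p * P                          ≈⟨ *-congʳ (∏-except₀-const a) ⟨
    Π.sum (except₀ (λ _ → a)) * P      ≈⟨ Π.∑-distrib-+ (except₀ (λ _ → a)) (except₀ from) ⟨
    Π.sum (λ i → except₀ (λ _ → a) i * except₀ from i)
                                       ≈⟨ Π.sum-cong-≋ scaled ⟨
    Π.sum (λ i → except₀ from (to (a * from i)))
                                       ≈⟨ Π.sum-permute (except₀ from) scale ⟨
    P                                  ≈⟨ *-identityʳ P ⟨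
    P * 1#                             ∎)
    where
    P : Carrier
    P = Π.sum (except₀ from)

    P≉0 : ¬ (P ≈ 0#)
    P≉0 = ∏≉0 (except₀ from) (except₀-≉0 λ i i≢i₀ → i≢i₀ ∘ from≈0⇒≡i₀)

    undo : ∀ {u v} → u * v ≈ 1# → ∀ x → u * (v * x) ≈ x
    undo {u} {v} uv≈1 x =
      trans (sym (*-assoc u v x)) (trans (*-congʳ uv≈1) (*-identityˡ x))

    scale : Permutation′ (suc p)
    scale = conjugate (a *_) (b *_) *-congˡ *-congˡ (undo ab≈1) (undo (trans (*-comm b a) ab≈1))

    scaled : ∀ i → except₀ from (to (a * from i)) ≈ except₀ (λ _ → a) i * except₀ from i
    scaled i with i Fin.≟ i₀
    -- Since a · 0 = 0, the index `i₀` is fixed by the scaling and both sides are 1. At any other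
    -- index a · x is nonzero, so the replacement by 1 is not triggered on either side.
    ... | yes ≡.refl = trans (except₀-i₀ from (to-cong (trans (*-congˡ (strictlyInverseʳ 0#)) (zeroʳ a))))
                             (sym (*-identityˡ 1#))
    ... | no i≢i₀ = trans (except₀-≢ from (λ eq → x*y≉0 a≉0 (i≢i₀ ∘ from≈0⇒≡i₀)
                            (trans (sym (strictlyInverseʳ _)) (trans (from-cong eq) (strictlyInverseʳ 0#)))))
                          (strictlyInverseʳ _)

-- Polynomials: coefficients, degree and values of β

module PolynomialProperties {c ℓ} (F : Field c ℓ) where
  open Field F hiding (zero)
  open Polynomials F
  open Exp semiring using (_^_; ^-congˡ)
  open Mult semiring using (_×_)
  open ≈-Reasoning setoid

  terms : ∀ {n} → List (Exponent n) → Poly n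
  terms = List.map (1# ,_)

  sumₚ-monomials : ∀ {n} (es : List (Exponent n)) → sumₚ (List.map monomial es) ≡ terms es
  sumₚ-monomials []       = ≡.refl
  sumₚ-monomials (e ∷ es) = ≡.cong ((1# , e) ∷_) (sumₚ-monomials es)

  -- As all terms have coefficient 1, both coefficients and values of β become sums over two lists
  -- of exponents.
  β-terms : ∀ q n → β q n ≡ terms (box (q ℕ.∸ 2) n) ++ terms (List.map unitExponent (List.allFin n))
  β-terms q n = ≡.cong₂ _++_ (sumₚ-monomials (box (q ℕ.∸ 2) n))
    (≡.trans (≡.cong sumₚ (List.map-∘ (List.allFin n)))
             (sumₚ-monomials (List.map unitExponent (List.allFin n))))

  sumᶠ-++ : ∀ xs ys → sumᶠ (xs ++ ys) ≈ sumᶠ xs + sumᶠ ys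
  sumᶠ-++ []       ys = sym (+-identityˡ _)
  sumᶠ-++ (x ∷ xs) ys = trans (+-congˡ (sumᶠ-++ xs ys)) (sym (+-assoc _ _ _))

  sumᶠ-map-++ : ∀ {a} {A : Set a} (f : A → Carrier) xs ys →
                sumᶠ (List.map f (xs ++ ys)) ≈ sumᶠ (List.map f xs) + sumᶠ (List.map f ys)
  sumᶠ-map-++ f xs ys = trans (reflexive (≡.cong sumᶠ (List.map-++ f xs ys)))
                            (sumᶠ-++ (List.map f xs) (List.map f ys))

  sumᶠ-map-cong : ∀ {a} {A : Set a} {f g : A → Carrier} → (∀ x → f x ≈ g x) →
                  ∀ xs → sumᶠ (List.map f xs) ≈ sumᶠ (List.map g xs)
  sumᶠ-map-cong f≈g []       = refl
  sumᶠ-map-cong f≈g (x ∷ xs) = +-cong (f≈g x) (sumᶠ-map-cong f≈g xs)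

  -- Coefficients

  -- If `e` were not among the listed exponents, every summand of its coefficient would be 0. This
  -- yields the upper bound on the degree.
  coeff-All : ∀ {n p} {P : Exponent n → Set p} {f : Poly n} {e} →
              All (P ∘ proj₂) f → ¬ (coeff f e ≈ 0#) → P e
  coeff-All []                            nz = contradiction refl nz
  coeff-All {f = (a , e′) ∷ f} {e} (p ∷ ps) nz with e ≟ᵉ e′
  ... | yes ≡.refl = p
  ... | no _       = coeff-All ps (nz ∘ trans (+-identityˡ _))

  coeff-terms-∉ : ∀ {n} {es : List (Exponent n)} {e} → All (e ≢_) es → coeff (terms es) e ≈ 0#
  coeff-terms-∉ []                               = refl
  coeff-terms-∉ {es = e′ ∷ _} {e} (e≢e′ ∷ e∉es) with e ≟ᵉ e′
  ... | yes e≡e′ = contradiction e≡e′ e≢e′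
  ... | no _     = trans (+-identityˡ _) (coeff-terms-∉ e∉es)

  coeff-terms-∈ : ∀ {n} {es : List (Exponent n)} {e} → Unique es → e ∈ es → coeff (terms es) e ≈ 1#
  coeff-terms-∈ {es = e′ ∷ _} {e} (e′∉es ∷ _) (here e≡e′) with e ≟ᵉ e′
  ... | yes ≡.refl = trans (+-congˡ (coeff-terms-∉ e′∉es)) (+-identityʳ 1#)
  ... | no e≢e′    = contradiction e≡e′ e≢e′
  coeff-terms-∈ {es = e′ ∷ _} {e} (e′∉es ∷ u) (there e∈es) with e ≟ᵉ e′
  ... | yes ≡.refl = contradiction ≡.refl (All.lookup e′∉es e∈es)
  ... | no _       = trans (+-identityˡ _) (coeff-terms-∈ u e∈es)

  -- The exponent (m, ..., m) occurs once in the box and is not a unit exponent, so its coefficient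
  -- is 1 + 0. Nothing exceeds its degree: the linear terms have degree 1, which is at most n · m as
  -- both factors are positive.
  β-degree : ∀ {m n} → 2 ℕ.≤ m → 1 ℕ.≤ n → HasDegree (β (2 ℕ.+ m) n) (n ℕ.* m)
  β-degree {m@(suc m′)} {n} 2≤m 1≤n rewrite β-terms (2 ℕ.+ m) n =
    (top , sum-replicate n m , λ eq → 1≉0 (trans (sym coeff-top) eq)) ,
    λ e → coeff-All {P = λ e → Vec.sum e ℕ.≤ n ℕ.* m} {e = e}
      (All.++⁺ (All.map⁺ (box-sum≤ m n))
               (All.map⁺ (All.map⁺ (All.tabulate⁺ λ i →
                 ℕ.≤-trans (ℕ.≤-reflexive (sum-unitExponent i)) (ℕ.*-mono-≤ 1≤n (s≤s {n = m′} z≤n))))))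
    where
    top : Exponent n
    top = Vec.replicate n m

    units : List (Exponent n)
    units = List.map unitExponent (List.allFin n)

    coeff-top : coeff (terms (box m n) ++ terms units) top ≈ 1#
    coeff-top = begin
      coeff (terms (box m n) ++ terms units) top
        ≈⟨ sumᶠ-map-++ _ (terms (box m n)) (terms units) ⟩
      coeff (terms (box m n)) top + coeff (terms units) top
        ≈⟨ +-cong (coeff-terms-∈ (box-unique m n) (replicate∈box m′ n))
                  (coeff-terms-∉ {es = units} (All.map⁺ (All.tabulate⁺ λ i → replicate≢unitExponent i 2≤m))) ⟩
      1# + 0#
        ≈⟨ +-identityʳ 1# ⟩
      1# ∎

  -- Evaluation

  -- Once `e` is itself written as an insertion at `i`, the factors at `i` line up and the one for
  -- `x` splits off.
  power-insertAt : ∀ {n} (a : Vec Carrier n) (e : Exponent (suc n)) i x →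
                   power (Vec.insertAt a i x) e ≈ x ^ Vec.lookup e i * power a (Vec.removeAt e i)
  power-insertAt a e i x = begin
    power (Vec.insertAt a i x) e
      ≡⟨ ≡.cong (power (Vec.insertAt a i x)) (Vec.insertAt-removeAt e i) ⟨
    power (Vec.insertAt a i x) (Vec.insertAt (Vec.removeAt e i) i (Vec.lookup e i))
      ≡⟨ ≡.cong (Vec.foldr′ _*_ 1#) (zipWith-insertAt _^_ a _ i x _) ⟩
    Vec.foldr′ _*_ 1# (Vec.insertAt (Vec.zipWith _^_ a (Vec.removeAt e i)) i (x ^ Vec.lookup e i))
      ≈⟨ foldr′-insertAt *-commutativeMonoid (Vec.zipWith _^_ a (Vec.removeAt e i)) i _ ⟩
    x ^ Vec.lookup e i * power a (Vec.removeAt e i) ∎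

  induced-specialise : ∀ {n} (f : Poly (suc n)) i a x →
                       induced (specialise i a f) x ≈ eval f (Vec.insertAt a i x)
  induced-specialise f i a x = begin
    induced (specialise i a f) x
      ≡⟨ ≡.cong sumᶠ (List.map-∘ f) ⟨
    -- The trailing `1#` is the end of the fold over the one-entry exponent made by `specialise`.
    sumᶠ (List.map (λ (b , e) → b * power a (Vec.removeAt e i) * (x ^ Vec.lookup e i * 1#)) f)
      ≈⟨ sumᶠ-map-cong term f ⟩
    eval f (Vec.insertAt a i x) ∎
    where
    term : ∀ t → proj₁ t * power a (Vec.removeAt (proj₂ t) i) * (x ^ Vec.lookup (proj₂ t) i * 1#) ≈
                 proj₁ t * power (Vec.insertAt a i x) (proj₂ t)
    term (b , e) = begin
      b * power a (Vec.removeAt e i) * (x ^ Vec.lookup e i * 1#)  ≈⟨ *-congˡ (*-identityʳ _) ⟩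
      b * power a (Vec.removeAt e i) * x ^ Vec.lookup e i         ≈⟨ *-assoc _ _ _ ⟩
      b * (power a (Vec.removeAt e i) * x ^ Vec.lookup e i)       ≈⟨ *-congˡ (*-comm _ _) ⟩
      b * (x ^ Vec.lookup e i * power a (Vec.removeAt e i))       ≈⟨ *-congˡ (power-insertAt a e i x) ⟨
      b * power (Vec.insertAt a i x) e                            ∎

  eval-terms : ∀ {n} (es : List (Exponent n)) a → eval (terms es) a ≈ sumᶠ (List.map (power a) es)
  eval-terms es a = trans (reflexive (≡.cong sumᶠ (≡.sym (List.map-∘ es))))
                          (sumᶠ-map-cong (λ e → *-identityˡ (power a e)) es)

  power-replicate-0 : ∀ {n} (a : Vec Carrier n) → power a (Vec.replicate n 0) ≈ 1#
  power-replicate-0 []      = refl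
  power-replicate-0 (x ∷ a) = trans (*-identityˡ _) (power-replicate-0 a)

  power-unitExponent : ∀ {n} (a : Vec Carrier n) i → power a (unitExponent i) ≈ Vec.lookup a i
  power-unitExponent (x ∷ a) zero    =
    trans (*-cong (*-identityʳ x) (power-replicate-0 a)) (*-identityʳ x)
  power-unitExponent (x ∷ a) (suc i) = trans (*-identityˡ _) (power-unitExponent a i)

  sumᶠ-lookup : ∀ {n} (a : Vec Carrier n) → sumᶠ (List.tabulate (Vec.lookup a)) ≈ Vec.foldr′ _+_ 0# a
  sumᶠ-lookup []      = refl
  sumᶠ-lookup (x ∷ a) = +-congˡ (sumᶠ-lookup a)

  eval-units : ∀ {n} (a : Vec Carrier n) →
               eval (terms (List.map unitExponent (List.allFin n))) a ≈ Vec.foldr′ _+_ 0# a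
  eval-units {n} a = begin
    eval (terms (List.map unitExponent (List.allFin n))) a
      ≈⟨ eval-terms (List.map unitExponent (List.allFin n)) a ⟩
    sumᶠ (List.map (power a) (List.map unitExponent (List.allFin n)))
      ≡⟨ ≡.cong sumᶠ (List.map-∘ (List.allFin n)) ⟨
    sumᶠ (List.map (power a ∘ unitExponent) (List.allFin n))
      ≈⟨ sumᶠ-map-cong (power-unitExponent a) (List.allFin n) ⟩
    sumᶠ (List.map (Vec.lookup a) (List.allFin n))
      ≡⟨ ≡.cong sumᶠ (List.map-tabulate (λ i → i) (Vec.lookup a)) ⟩
    sumᶠ (List.tabulate (Vec.lookup a))
      ≈⟨ sumᶠ-lookup a ⟩
    Vec.foldr′ _+_ 0# a ∎

  -- Power sums: factorisation of the large sum and the geometric identity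

  powerSum : ℕ → Carrier → Carrier
  powerSum m x = sumᶠ (List.map (x ^_) (List.map suc (List.upTo m)))

  powerSum-cong : ∀ m {x y} → x ≈ y → powerSum m x ≈ powerSum m y
  powerSum-cong m x≈y = sumᶠ-map-cong (λ k → ^-congˡ k x≈y) (List.map suc (List.upTo m))

  sumᶠ-map-*ˡ : ∀ {a} {A : Set a} (f : A → Carrier) x ys →
                sumᶠ (List.map (λ y → x * f y) ys) ≈ x * sumᶠ (List.map f ys)
  sumᶠ-map-*ˡ f x []       = sym (zeroʳ x)
  sumᶠ-map-*ˡ f x (y ∷ ys) = trans (+-congˡ (sumᶠ-map-*ˡ f x ys)) (sym (distribˡ x _ _))

  -- This is distributivity, applied to one exponent `k` of the first variable at a time. Iterated
  -- over the variables, it splits the sum over the box into a product of power sums.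
  sumᶠ-power-cartesianProduct :
    ∀ {n} x (a : Vec Carrier n) ks es →
    sumᶠ (List.map (power (x ∷ a)) (List.cartesianProductWith _∷_ ks es)) ≈
    sumᶠ (List.map (x ^_) ks) * sumᶠ (List.map (power a) es)
  sumᶠ-power-cartesianProduct x a []       es = sym (zeroˡ _)
  sumᶠ-power-cartesianProduct x a (k ∷ ks) es = begin
    sumᶠ (List.map (power (x ∷ a)) (List.map (k ∷_) es ++ List.cartesianProductWith _∷_ ks es))
      ≈⟨ sumᶠ-map-++ (power (x ∷ a)) (List.map (k ∷_) es) _ ⟩
    sumᶠ (List.map (power (x ∷ a)) (List.map (k ∷_) es)) +
    sumᶠ (List.map (power (x ∷ a)) (List.cartesianProductWith _∷_ ks es))
      ≈⟨ +-cong (trans (reflexive (≡.cong sumᶠ (≡.sym (List.map-∘ es)))) (sumᶠ-map-*ˡ (power a) (x ^ k) es))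
                (sumᶠ-power-cartesianProduct x a ks es) ⟩
    x ^ k * sumᶠ (List.map (power a) es) + sumᶠ (List.map (x ^_) ks) * sumᶠ (List.map (power a) es)
      ≈⟨ distribʳ _ _ _ ⟨
    sumᶠ (List.map (x ^_) (k ∷ ks)) * sumᶠ (List.map (power a) es) ∎

  sumᶠ-power-box : ∀ m {n} (a : Vec Carrier n) →
                   sumᶠ (List.map (power a) (box m n)) ≈ Vec.foldr′ _*_ 1# (Vec.map (powerSum m) a)
  sumᶠ-power-box m []      = +-identityʳ 1#
  sumᶠ-power-box m (x ∷ a) =
    trans (sumᶠ-power-cartesianProduct x a (List.map suc (List.upTo m)) (box m _))
          (*-congˡ (sumᶠ-power-box m a))

  eval-β : ∀ m {n} (a : Vec Carrier n) →
           eval (β (2 ℕ.+ m) n) a ≈ Vec.foldr′ _*_ 1# (Vec.map (powerSum m) a) + Vec.foldr′ _+_ 0# a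
  eval-β m {n} a = begin
    eval (β (2 ℕ.+ m) n) a
      ≡⟨ ≡.cong (λ f → eval f a) (β-terms (2 ℕ.+ m) n) ⟩
    eval (terms (box m n) ++ terms (List.map unitExponent (List.allFin n))) a
      ≈⟨ sumᶠ-map-++ _ (terms (box m n)) _ ⟩
    eval (terms (box m n)) a + eval (terms (List.map unitExponent (List.allFin n))) a
      ≈⟨ +-cong (trans (eval-terms (box m n) a) (sumᶠ-power-box m a)) (eval-units a) ⟩
    Vec.foldr′ _*_ 1# (Vec.map (powerSum m) a) + Vec.foldr′ _+_ 0# a ∎

  -- The factor and the summand of coordinate `i` are brought to the front. What remains are the
  -- constants c = ∏ S(aⱼ) and d = ∑ aⱼ of the map S(x)·c + x + d.
  induced-specialise-β :
    ∀ m {n} (i : Fin (suc n)) a x →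
    induced (specialise i a (β (2 ℕ.+ m) (suc n))) x ≈
    powerSum m x * Vec.foldr′ _*_ 1# (Vec.map (powerSum m) a) + x + Vec.foldr′ _+_ 0# a
  induced-specialise-β m {n} i a x = begin
    induced (specialise i a (β (2 ℕ.+ m) (suc n))) x
      ≈⟨ induced-specialise (β (2 ℕ.+ m) (suc n)) i a x ⟩
    eval (β (2 ℕ.+ m) (suc n)) (Vec.insertAt a i x)
      ≈⟨ eval-β m (Vec.insertAt a i x) ⟩
    Vec.foldr′ _*_ 1# (Vec.map (powerSum m) (Vec.insertAt a i x)) + Vec.foldr′ _+_ 0# (Vec.insertAt a i x)
      ≡⟨ ≡.cong (λ v → Vec.foldr′ _*_ 1# v + Vec.foldr′ _+_ 0# (Vec.insertAt a i x))
                (Vec.map-insertAt (powerSum m) x a i) ⟩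
    Vec.foldr′ _*_ 1# (Vec.insertAt (Vec.map (powerSum m) a) i (powerSum m x)) +
    Vec.foldr′ _+_ 0# (Vec.insertAt a i x)
      ≈⟨ +-cong (foldr′-insertAt *-commutativeMonoid (Vec.map (powerSum m) a) i _)
                (foldr′-insertAt +-commutativeMonoid a i x) ⟩
    powerSum m x * Vec.foldr′ _*_ 1# (Vec.map (powerSum m) a) + (x + Vec.foldr′ _+_ 0# a)
      ≈⟨ +-assoc _ _ _ ⟨
    powerSum m x * Vec.foldr′ _*_ 1# (Vec.map (powerSum m) a) + x + Vec.foldr′ _+_ 0# a ∎

  -- Multiplication by `x` shifts the sequence, so both sides equal f 0 + ⋯ + f m. A general `f`
  -- lets the induction pass to `f ∘ suc`, and the form without subtraction needs no division by x -
  -- 1.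
  sumᶠ-geometric : ∀ x (f : ℕ → Carrier) → (∀ i → f (suc i) ≈ x * f i) → ∀ m →
                   x * sumᶠ (List.applyUpTo f m) + f 0 ≈ sumᶠ (List.applyUpTo f m) + f m
  sumᶠ-geometric x f step zero    = +-congʳ (zeroʳ x)
  sumᶠ-geometric x f step (suc m) = begin
    x * (f 0 + R) + f 0        ≈⟨ +-congʳ (distribˡ x _ _) ⟩
    (x * f 0 + x * R) + f 0    ≈⟨ +-congʳ (+-congʳ (step 0)) ⟨
    (f 1 + x * R) + f 0        ≈⟨ +-comm _ _ ⟩
    f 0 + (f 1 + x * R)        ≈⟨ +-congˡ (+-comm _ _) ⟩
    f 0 + (x * R + f 1)        ≈⟨ +-congˡ (sumᶠ-geometric x (f ∘ suc) (step ∘ suc) m) ⟩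
    f 0 + (R + f (suc m))      ≈⟨ +-assoc _ _ _ ⟨
    f 0 + R + f (suc m)        ∎
    where
    R : Carrier
    R = sumᶠ (List.applyUpTo (f ∘ suc) m)

  powerSum-applyUpTo : ∀ m x → powerSum m x ≡ sumᶠ (List.applyUpTo (λ i → x ^ suc i) m)
  powerSum-applyUpTo m x = ≡.cong sumᶠ
    (≡.trans (≡.cong (List.map (x ^_)) (List.map-upTo suc m)) (List.map-applyUpTo suc (x ^_) m))

  -- Both sides are x + ⋯ + x^(m+1). For m = q - 2 the last power is x^(q-1), to which Fermat's
  -- theorem applies.
  powerSum-geometric : ∀ m x → x * powerSum m x + x ≈ powerSum m x + x ^ suc m
  powerSum-geometric m x rewrite powerSum-applyUpTo m x =
    trans (+-congˡ (sym (*-identityʳ x))) (sumᶠ-geometric x (λ i → x ^ suc i) (λ _ → refl) m)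

  1^n≈1 : ∀ n → 1# ^ n ≈ 1#
  1^n≈1 zero    = refl
  1^n≈1 (suc n) = trans (*-identityˡ _) (1^n≈1 n)

  sumᶠ-map-1 : ∀ {a} {A : Set a} {f : A → Carrier} → (∀ x → f x ≈ 1#) → ∀ xs →
               sumᶠ (List.map f xs) ≈ List.length xs × 1#
  sumᶠ-map-1 f≈1 []       = refl
  sumᶠ-map-1 f≈1 (x ∷ xs) = +-cong (f≈1 x) (sumᶠ-map-1 f≈1 xs)

  -- At 1 the geometric identity says nothing about the power sum, so its `m` terms are counted
  -- instead.
  powerSum-1 : ∀ m → powerSum m 1# ≈ m × 1#
  powerSum-1 m = trans (sumᶠ-map-1 1^n≈1 (List.map suc (List.upTo m))) (reflexive (≡.cong (_× 1#)
    (≡.trans (List.length-map suc (List.upTo m)) (List.length-upTo m))))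

-- Characteristic two: the values of S and bijectivity

module CharacteristicTwo {c ℓ} (F : Field c ℓ) {m : ℕ} (card : HasCardinality F (2 ℕ.+ m))
                         (1+1≈0 : Field._≈_ F (Field._+_ F (Field.1# F) (Field.1# F)) (Field.0# F)) where
  open Field F hiding (zero)
  open FieldProperties F
  open FiniteFieldProperties F card
  open Polynomials F
  open PolynomialProperties F
  open Mult semiring using (_×_)
  open GroupProperties +-group using (∙-cancelʳ; //-rightDividesˡ)
  open ≈-Reasoning setoid

  x+x≈0 : ∀ x → x + x ≈ 0#
  x+x≈0 x = begin
    x + x              ≈⟨ +-cong (*-identityʳ x) (*-identityʳ x) ⟨
    x * 1# + x * 1#    ≈⟨ distribˡ x 1# 1# ⟨
    x * (1# + 1#)      ≈⟨ *-congˡ 1+1≈0 ⟩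
    x * 0#             ≈⟨ zeroʳ x ⟩
    0#                 ∎

  x+[x+y]≈y : ∀ x y → x + (x + y) ≈ y
  x+[x+y]≈y x y = trans (sym (+-assoc x x y)) (trans (+-congʳ (x+x≈0 x)) (+-identityˡ y))

  x+y≈0⇒y≈x : ∀ {x y} → x + y ≈ 0# → y ≈ x
  x+y≈0⇒y≈x {x} {y} eq = trans (sym (x+[x+y]≈y x y)) (trans (+-congˡ eq) (+-identityʳ x))

  -- The prime subfield, in which S takes its values and on which S vanishes.
  Bit : Carrier → Set ℓ
  Bit x = x ≈ 0# ⊎ x ≈ 1#

  bit? : ∀ x → Bit x ⊎ ¬ Bit x
  bit? x with x ≟ 0# | x ≟ 1#
  ... | yes x≈0 | _       = inj₁ (inj₁ x≈0)
  ... | no _    | yes x≈1 = inj₁ (inj₂ x≈1)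
  ... | no x≉0  | no x≉1  = inj₂ λ { (inj₁ x≈0) → x≉0 x≈0 ; (inj₂ x≈1) → x≉1 x≈1 }

  Bit-* : ∀ {x y} → Bit x → Bit y → Bit (x * y)
  Bit-* (inj₁ x≈0) _  = inj₁ (trans (*-congʳ x≈0) (zeroˡ _))
  Bit-* (inj₂ x≈1) by with by
  ... | inj₁ y≈0 = inj₁ (trans (*-congˡ y≈0) (zeroʳ _))
  ... | inj₂ y≈1 = inj₂ (trans (*-cong x≈1 y≈1) (*-identityˡ 1#))

  Bit-1+⁻ : ∀ {x} → Bit (1# + x) → Bit x
  Bit-1+⁻ (inj₁ eq) = inj₂ (x+y≈0⇒y≈x eq)
  Bit-1+⁻ (inj₂ eq) = inj₁ (trans (sym (x+[x+y]≈y 1# _)) (trans (+-congˡ eq) 1+1≈0))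

  Bit-1+ : ∀ {x} → Bit x → Bit (1# + x)
  Bit-1+ (inj₁ x≈0) = inj₂ (trans (+-congˡ x≈0) (+-identityʳ 1#))
  Bit-1+ (inj₂ x≈1) = inj₁ (trans (+-congˡ x≈1) 1+1≈0)

  S : Carrier → Carrier
  S = powerSum m

  S-bit : ∀ {x} → Bit x → S x ≈ 0#
  -- At 0 the geometric identity collapses to `0# ≈ S 0#`.
  S-bit (inj₁ x≈0) = trans (powerSum-cong m x≈0) (sym (begin
    0#                       ≈⟨ +-identityʳ 0# ⟨
    0# + 0#                  ≈⟨ +-congʳ (zeroˡ _) ⟨
    0# * S 0# + 0#           ≈⟨ powerSum-geometric m 0# ⟩
    S 0# + 0# * _            ≈⟨ +-congˡ (zeroˡ _) ⟩
    S 0# + 0#                ≈⟨ +-identityʳ _ ⟩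
    S 0#                     ∎))
  S-bit (inj₂ x≈1) = begin
    S _                      ≈⟨ powerSum-cong m x≈1 ⟩
    S 1#                     ≈⟨ powerSum-1 m ⟩
    -- Adding 1 twice changes nothing, so `m` may be replaced by the cardinality.
    m × 1#                   ≈⟨ x+[x+y]≈y 1# _ ⟨
    (2 ℕ.+ m) × 1#           ≈⟨ q×1≈0 ⟩
    0#                       ∎

  -- With x^(q-1) = 1 the geometric identity reads (S(x) + 1)·x = (S(x) + 1)·1. As x is not 1,
  -- cancellation is impossible, so S(x) + 1 = 0, which means S(x) = 1 in characteristic 2.
  S-nonbit : ∀ {x} → ¬ Bit x → S x ≈ 1#
  S-nonbit {x} ¬bit with S x + 1# ≟ 0#
  ... | yes eq = sym (x+y≈0⇒y≈x eq)
  ... | no neq = contradiction (inj₂ (*-cancelˡ neq (begin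
    (S x + 1#) * x      ≈⟨ *-comm _ _ ⟩
    x * (S x + 1#)      ≈⟨ distribˡ x _ _ ⟩
    x * S x + x * 1#    ≈⟨ +-congˡ (*-identityʳ x) ⟩
    x * S x + x         ≈⟨ powerSum-geometric m x ⟩
    S x + _             ≈⟨ +-congˡ (fermat F card (¬bit ∘ inj₁)) ⟩
    S x + 1#            ≈⟨ *-identityʳ _ ⟨
    (S x + 1#) * 1#     ∎))) ¬bit

  S-Bit : ∀ x → Bit (S x)
  S-Bit x with bit? x
  ... | inj₁ bit  = inj₁ (S-bit bit)
  ... | inj₂ ¬bit = inj₂ (S-nonbit ¬bit)

  -- Adding 1 preserves both {0, 1} and its complement, and S is constant on each of them.
  S-1+ : ∀ x → S (1# + x) ≈ S x
  S-1+ x with bit? x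
  ... | inj₁ bit  = trans (S-bit (Bit-1+ bit)) (sym (S-bit bit))
  ... | inj₂ ¬bit = trans (S-nonbit (¬bit ∘ Bit-1+⁻)) (sym (S-nonbit ¬bit))

  S-Bit+ : ∀ {u} → Bit u → ∀ x → S (u + x) ≈ S x
  S-Bit+ (inj₁ u≈0) x = powerSum-cong m (trans (+-congʳ u≈0) (+-identityˡ x))
  S-Bit+ (inj₂ u≈1) x = trans (powerSum-cong m (+-congʳ u≈1)) (S-1+ x)

  ∏S-Bit : ∀ {n} (a : Vec Carrier n) → Bit (Vec.foldr′ _*_ 1# (Vec.map S a))
  ∏S-Bit []      = inj₂ refl
  ∏S-Bit (x ∷ a) = Bit-* (S-Bit x) (∏S-Bit a)

  module _ {b} (bit : Bit b) where
    g : Carrier → Carrier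
    g x = S x * b + x

    g-cong : ∀ {x y} → x ≈ y → g x ≈ g y
    g-cong x≈y = +-cong (*-congʳ (powerSum-cong m x≈y)) x≈y

    g-involutive : ∀ x → g (g x) ≈ x
    g-involutive x = begin
      S (g x) * b + (S x * b + x)  ≈⟨ +-congʳ (*-congʳ (S-Bit+ (Bit-* (S-Bit x) bit) x)) ⟩
      S x * b + (S x * b + x)      ≈⟨ x+[x+y]≈y (S x * b) x ⟩
      x                            ∎

    -- An involution followed by a translation is bijective. The map `f` is only assumed pointwise
    -- equal to this composite, since that is what is known of the induced map of β.
    g+d-bijective : ∀ d {f : Carrier → Carrier} → (∀ x → f x ≈ g x + d) → Bijective _≈_ _≈_ f
    g+d-bijective d {f} f≈ = injective , surjective
      where
      injective : ∀ {x y} → f x ≈ f y → x ≈ y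
      injective {x} {y} fx≈fy = begin
        x        ≈⟨ g-involutive x ⟨
        g (g x)  ≈⟨ g-cong (∙-cancelʳ d _ _ (trans (sym (f≈ x)) (trans fx≈fy (f≈ y)))) ⟩
        g (g y)  ≈⟨ g-involutive y ⟩
        y        ∎

      surjective : ∀ y → ∃ λ x → ∀ {z} → z ≈ x → f z ≈ y
      -- Undo the translation by `d`, then apply `g`, which is its own inverse.
      surjective y = g (y - d) , λ {z} z≈ → begin
        f z                ≈⟨ f≈ z ⟩
        g z + d            ≈⟨ +-congʳ (g-cong z≈) ⟩
        g (g (y - d)) + d  ≈⟨ +-congʳ (g-involutive (y - d)) ⟩
        y - d + d          ≈⟨ //-rightDividesˡ d y ⟩
        y                  ∎

  β-isLPP : ∀ n → IsLPP (β (2 ℕ.+ m) n)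
  -- For `n = 0` there is no index `i`, hence no clause.
  β-isLPP (suc n) i a =
    g+d-bijective (∏S-Bit a) (Vec.foldr′ _+_ 0# a) (induced-specialise-β m i a)

-- Specialisation to cardinality 2^r

open import Data.Nat using (ℕ; _*_; _∸_; _^_; _≤_; _<_)
open import Data.Product using (_×_)

-- The exponent must be at least 2. In terms of m = q - 2 this provides the bound m ≥ 2 on which the
-- degree computation rests.
2<2^r⇒4≤2^r : ∀ r → 2 < 2 ^ r → 4 ≤ 2 ^ r
2<2^r⇒4≤2^r zero          (s≤s ())
2<2^r⇒4≤2^r (suc zero)    (s≤s (s≤s ()))
2<2^r⇒4≤2^r (suc (suc r)) _ = ℕ.^-monoʳ-≤ 2 (s≤s (s≤s (z≤n {r})))

mainTheorem9 : ∀ {c ℓ} (r n : ℕ) → 2 < 2 ^ r → 1 ≤ n →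
    (F : Field c ℓ) → HasCardinality F (2 ^ r) →
    let open Polynomials F in
    IsLPP (β (2 ^ r) n) × HasDegree (β (2 ^ r) n) (n * (2 ^ r ∸ 2))
mainTheorem9 r n 2<2^r 1≤n F card = withCardinality (2 ^ r) (2<2^r⇒4≤2^r r 2<2^r) card
  where
  open Field F using (_≈_; _+_; 1#; 0#)
  open Polynomials F
  open FiniteFieldProperties F card using (_≟_; q×1≈0)

  1+1≈0 : 1# + 1# ≈ 0#
  -- Equality is decidable in a finite field, which removes the double negation.
  1+1≈0 = decidable-stable (1# + 1# ≟ 0#) (FieldProperties.2^r×1≈0⇒¬1+1≉0 F r q×1≈0)

  -- With a variable `q` in place of `2 ^ r`, matching on the bound exposes `q` as 2 + m. The
  -- characteristic was determined before, where the cardinality is still visibly a power of 2.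
  withCardinality : ∀ q → 4 ≤ q → HasCardinality F q →
                    IsLPP (β q n) × HasDegree (β q n) (n * (q ∸ 2))
  withCardinality (suc (suc m)) (s≤s (s≤s 2≤m)) card′ =
    CharacteristicTwo.β-isLPP F card′ 1+1≈0 n , PolynomialProperties.β-degree F 2≤m 1≤n
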